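{- Let $W$ be a move sequence, $\tau_0\in\{\pm1\}^{V(W)}$, and let $C=(c_1,\dots,c_t)$ be a cycle of $W$ with $t$ even. If all of $W_{c_1},\dots,W_{c_t}$ are of different signs, then $C$ is a dependent cycle; if all of $W_{c_1},\dots,W_{c_t}$ are of the same sign, then $C$ is a dependent cycle.
   Context: A move sequence over $[n]$ is $W=(W_1,\dots,W_L)$ with each $W_i\subseteq[n]$ of size 1 or 2; $V(W)$ is the set of nodes occurring in it. Given $\tau_0\in\{\pm1\}^{V(W)}$, $\tau_i$ is obtained from $\tau_{i-1}$ by flipping the signs of the nodes in $W_i$. A 2-move $W_i=\{u,v\}$ is of the same sign if $\tau_i(u)=\tau_i(v)$ and of different signs if $\tau_i(u)\neq\tau_i(v)$. A cycle of $W$ is a tuple $(c_1,\dots,c_t)$, $t\ge2$, of distinct indices with $W_{c_j}=\{u_j,u_{j+1}\}$ for $j\in[t-1]$ and $W_{c_t}=\{u_t,u_1\}$. It is dependent if there exists $b\in\{\pm1\}^t$ with $b_j\tau_{c_j}(u_{j+1})+b_{j+1}\tau_{c_{j+1}}(u_{j+1})=0$ for all $j\in[t-1]$ and $b_t\tau_{c_t}(u_1)+b_1\tau_{c_1}(u_1)=0$. -}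

module Defs where

open import Data.Nat using (ℕ; zero; suc)
open import Data.Nat.DivMod using (_mod_)
open import Data.Fin using (Fin; zero; suc; toℕ)
open import Data.Fin.Subset using (Subset; _∈_; ∣_∣; inside; outside)
open import Data.Vec using (Vec; []; _∷_; lookup)
open import Data.Sign using (Sign; opposite)
open import Data.Integer using (ℤ; 1ℤ; -1ℤ; _+_; _*_; 0ℤ)
open import Data.Product using (Σ; ∃; _×_; _,_)
open import Data.Sum using (_⊎_)
open import Relation.Binary.PropositionalEquality using (_≡_; _≢_)
open import Function.Definitions using (Injective)

-- A sign ±1 viewed as an integer.
⟦_⟧ : Sign → ℤ
⟦ Sign.+ ⟧ = 1ℤ
⟦ Sign.- ⟧ = -1ℤ

-- A move is a subset of [n] (= Fin n) of size 1 or 2.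
IsMove : {n : ℕ} → Subset n → Set
IsMove S = ∣ S ∣ ≡ 1 ⊎ ∣ S ∣ ≡ 2

-- A move sequence W = (W_1,…,W_L), stored 0-based: W_{i+1} = lookup W i.
MoveSeq : ℕ → ℕ → Set
MoveSeq n L = Σ (Vec (Subset n) L) λ W → (i : Fin L) → IsMove (lookup W i)

-- Sign configurations.
Config : ℕ → Set
Config n = Fin n → Sign

-- Flip the signs of the nodes in S.
flipBy : {n : ℕ} → Subset n → Config n → Config n
flipBy S σ x with lookup S x
... | inside  = opposite (σ x)
... | outside = σ x

-- τs W τ₀ i = τ_{i+1}, the configuration after applying W_1,…,W_{i+1}.
τs : {n L : ℕ} → Vec (Subset n) L → Config n → Fin L → Config n
τs (S ∷ W) σ zero    = flipBy S σ
τs (S ∷ W) σ (suc i) = τs W (flipBy S σ) i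

-- The node set of S is exactly {a , b}.
NodesAre : {n : ℕ} → Subset n → Fin n → Fin n → Set
NodesAre S a b = ∀ x → (x ∈ S → (x ≡ a ⊎ x ≡ b)) × ((x ≡ a ⊎ x ≡ b) → x ∈ S)

-- The i-th move (0-based) is a 2-move {u,v} of different signs / of the same sign.
DifferentSigns : {n L : ℕ} → MoveSeq n L → Config n → Fin L → Set
DifferentSigns (W , _) τ₀ i =
  ∃ λ u → ∃ λ v → u ≢ v × NodesAre (lookup W i) u v × τs W τ₀ i u ≢ τs W τ₀ i v

SameSign : {n L : ℕ} → MoveSeq n L → Config n → Fin L → Set
SameSign (W , _) τ₀ i =
  ∃ λ u → ∃ λ v → u ≢ v × NodesAre (lookup W i) u v × τs W τ₀ i u ≡ τs W τ₀ i v

-- Cyclic successor j ↦ j+1 (mod t) on Fin t.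
next : {t : ℕ} → Fin t → Fin t
next {suc k} j = suc (toℕ j) mod suc k

-- A cycle (c_1,…,c_t) of W with vertices (u_1,…,u_t), 0-based:
-- distinct indices c, and W_{c_j} = {u_j, u_{j+1}} (indices of u mod t).
record Cycle {n L : ℕ} (W : MoveSeq n L) (t : ℕ) : Set where
  field
    c        : Fin t → Fin L
    u        : Fin t → Fin n
    c-inj    : Injective _≡_ _≡_ c
    c-edges  : ∀ j → NodesAre (lookup (Data.Product.proj₁ W) (c j)) (u j) (u (next j))
open Cycle public

-- C is dependent: ∃ b ∈ {±1}^t with
-- b_j τ_{c_j}(u_{j+1}) + b_{j+1} τ_{c_{j+1}}(u_{j+1}) = 0 for all j (cyclically).
Dependent : {n L t : ℕ} (W : MoveSeq n L) → Config n → Cycle W t → Set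
Dependent {t = t} (W , _) τ₀ C =
  ∃ λ (b : Fin t → Sign) → ∀ j →
    ⟦ b j ⟧ * ⟦ τs W τ₀ (c C j) (u C (next j)) ⟧
      + ⟦ b (next j) ⟧ * ⟦ τs W τ₀ (c C (next j)) (u C (next j)) ⟧ ≡ 0ℤ

-- Write a_j = τ_{c_j}(u_j) and a'_j = τ_{c_j}(u_{j+1}) for the signs at the two ends of the
-- j-th edge of the cycle; dependence asks for b with b_j a'_j = −b_{j+1} a_{j+1}.  If every
-- move has different signs then a'_j = −a_j, and b = a works.  If every move has the same
-- sign then a'_j = a_j, and b_j = (−1)^j a_j works, provided the alternation (−1)^j is
-- consistent around the cycle, i.e. t is even.
module Submission where

open import Defs
open import Data.Nat using (ℕ; zero; suc; _≤_; _%_)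
open import Data.Nat.Properties using (m≤n⇒m<n∨m≡n)
open import Data.Nat.DivMod using (m%n<n; m<n⇒m%n≡m; n%n≡0)
open import Data.Nat.Divisibility using (_∣_; divides)
open import Data.Fin using (Fin; toℕ)
open import Data.Fin.Properties using (toℕ-fromℕ<; toℕ<n)
open import Data.Sign using (Sign; opposite) renaming (_*_ to _⊛_)
open import Data.Sign.Properties
  using (opposite-involutive; s*s≡+; s*opposite[s]≡-; *-comm; *-assoc; *-identityʳ)
open import Data.Integer using (_+_; _*_; 0ℤ)
open import Data.Product using (_×_; _,_; proj₁; proj₂)
open import Data.Sum using (_⊎_; inj₁; inj₂)
open import Data.Empty using (⊥-elim)
open import Relation.Binary.Definitions using (Symmetric)
open import Relation.Binary.PropositionalEquality
  using (_≡_; _≢_; refl; sym; trans; cong; cong₂; ≢-sym; module ≡-Reasoning)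

⟦⟧-homo-* : ∀ s r → ⟦ s ⊛ r ⟧ ≡ ⟦ s ⟧ * ⟦ r ⟧
⟦⟧-homo-* Sign.+ Sign.+ = refl
⟦⟧-homo-* Sign.+ Sign.- = refl
⟦⟧-homo-* Sign.- Sign.+ = refl
⟦⟧-homo-* Sign.- Sign.- = refl

⟦opposite⟧-cancel : ∀ s → ⟦ opposite s ⟧ + ⟦ s ⟧ ≡ 0ℤ
⟦opposite⟧-cancel Sign.+ = refl
⟦opposite⟧-cancel Sign.- = refl

⟦⟧-*-cancel : ∀ s r s′ r′ → s ⊛ r ≡ opposite (s′ ⊛ r′) → ⟦ s ⟧ * ⟦ r ⟧ + ⟦ s′ ⟧ * ⟦ r′ ⟧ ≡ 0ℤ
⟦⟧-*-cancel s r s′ r′ eq = begin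
  ⟦ s ⟧ * ⟦ r ⟧ + ⟦ s′ ⟧ * ⟦ r′ ⟧   ≡⟨ cong₂ _+_ (sym (⟦⟧-homo-* s r)) (sym (⟦⟧-homo-* s′ r′)) ⟩
  ⟦ s ⊛ r ⟧ + ⟦ s′ ⊛ r′ ⟧           ≡⟨ cong (λ x → ⟦ x ⟧ + ⟦ s′ ⊛ r′ ⟧) eq ⟩
  ⟦ opposite (s′ ⊛ r′) ⟧ + ⟦ s′ ⊛ r′ ⟧ ≡⟨ ⟦opposite⟧-cancel (s′ ⊛ r′) ⟩
  0ℤ                                 ∎
  where open ≡-Reasoning

≢⇒≡opposite : ∀ {s r} → s ≢ r → r ≡ opposite s
≢⇒≡opposite {Sign.+} {Sign.+} s≢r = ⊥-elim (s≢r refl)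
≢⇒≡opposite {Sign.+} {Sign.-} _   = refl
≢⇒≡opposite {Sign.-} {Sign.+} _   = refl
≢⇒≡opposite {Sign.-} {Sign.-} s≢r = ⊥-elim (s≢r refl)

conjugate-sign : ∀ s p → (s ⊛ p) ⊛ s ≡ p
conjugate-sign s p = begin
  (s ⊛ p) ⊛ s ≡⟨ cong (_⊛ s) (*-comm s p) ⟩
  (p ⊛ s) ⊛ s ≡⟨ *-assoc p s s ⟩
  p ⊛ (s ⊛ s) ≡⟨ cong (p ⊛_) (s*s≡+ s) ⟩
  p ⊛ Sign.+  ≡⟨ *-identityʳ p ⟩
  p           ∎
  where open ≡-Reasoning

-- (−1)^m
alternating : ℕ → Sign
alternating zero    = Sign.+
alternating (suc m) = opposite (alternating m)

alternating-even : ∀ {m} → 2 ∣ m → alternating m ≡ Sign.+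
alternating-even (divides q refl) = go q
  where
  go : ∀ q → alternating (q Data.Nat.* 2) ≡ Sign.+
  go zero    = refl
  go (suc q) = cong (λ s → opposite (opposite s)) (go q)

alternating-next : ∀ {t} → 2 ∣ t → (j : Fin t) →
                   alternating (toℕ (next j)) ≡ opposite (alternating (toℕ j))
alternating-next {suc k} 2∣t j
  rewrite toℕ-fromℕ< (m%n<n (suc (toℕ j)) (suc k))
  with m≤n⇒m<n∨m≡n (toℕ<n j)
... | inj₁ j+1<t = cong alternating (m<n⇒m%n≡m j+1<t)
... | inj₂ j+1≡t = begin
  alternating (suc (toℕ j) % suc k) ≡⟨ cong (λ m → alternating (m % suc k)) j+1≡t ⟩
  alternating (suc k % suc k)       ≡⟨ cong alternating (n%n≡0 (suc k)) ⟩
  Sign.+                            ≡⟨ sym (alternating-even 2∣t) ⟩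
  alternating (suc k)               ≡⟨ cong alternating (sym j+1≡t) ⟩
  alternating (suc (toℕ j))         ∎
  where open ≡-Reasoning

NodesAre-unique : ∀ {n} {S} {u v p q : Fin n} → u ≢ v → NodesAre S u v → NodesAre S p q →
                  (u ≡ p × v ≡ q) ⊎ (u ≡ q × v ≡ p)
NodesAre-unique {u = u} {v} u≢v uv pq
  with proj₁ (pq u) (proj₂ (uv u) (inj₁ refl)) | proj₁ (pq v) (proj₂ (uv v) (inj₂ refl))
... | inj₁ u≡p | inj₁ v≡p = ⊥-elim (u≢v (trans u≡p (sym v≡p)))
... | inj₁ u≡p | inj₂ v≡q = inj₁ (u≡p , v≡q)
... | inj₂ u≡q | inj₁ v≡p = inj₂ (u≡q , v≡p)
... | inj₂ u≡q | inj₂ v≡q = ⊥-elim (u≢v (trans u≡q (sym v≡q)))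

NodesAre-respects : ∀ {n a} {A : Set a} {_~_ : A → A → Set} → Symmetric _~_ →
                    ∀ {S} {u v p q : Fin n} (σ : Fin n → A) →
                    u ≢ v → NodesAre S u v → NodesAre S p q → σ u ~ σ v → σ p ~ σ q
NodesAre-respects ~-sym σ u≢v uv pq σu~σv with NodesAre-unique u≢v uv pq
... | inj₁ (refl , refl) = σu~σv
... | inj₂ (refl , refl) = ~-sym σu~σv

module _ {n L t} (W : MoveSeq n L) (τ₀ : Config n) (C : Cycle W t) where

  signAtStart signAtEnd : Fin t → Sign
  signAtStart j = τs (proj₁ W) τ₀ (c C j) (u C j)
  signAtEnd   j = τs (proj₁ W) τ₀ (c C j) (u C (next j))

  dependent-by : (b : Fin t → Sign) →
                 (∀ j → b j ⊛ signAtEnd j ≡ opposite (b (next j) ⊛ signAtStart (next j))) →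
                 Dependent W τ₀ C
  dependent-by b cancels = b , λ j →
    ⟦⟧-*-cancel (b j) (signAtEnd j) (b (next j)) (signAtStart (next j)) (cancels j)

  differentSigns⇒ends-differ : ∀ j → DifferentSigns W τ₀ (c C j) → signAtStart j ≢ signAtEnd j
  differentSigns⇒ends-differ j (_ , _ , x≢y , xy , τx≢τy) =
    NodesAre-respects {_~_ = _≢_} ≢-sym (τs (proj₁ W) τ₀ (c C j)) x≢y xy (c-edges C j) τx≢τy

  sameSign⇒ends-agree : ∀ j → SameSign W τ₀ (c C j) → signAtStart j ≡ signAtEnd j
  sameSign⇒ends-agree j (_ , _ , x≢y , xy , τx≡τy) =
    NodesAre-respects {_~_ = _≡_} sym (τs (proj₁ W) τ₀ (c C j)) x≢y xy (c-edges C j) τx≡τy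

  differentSigns⇒dependent : (∀ j → DifferentSigns W τ₀ (c C j)) → Dependent W τ₀ C
  differentSigns⇒dependent different = dependent-by signAtStart λ j → begin
    signAtStart j ⊛ signAtEnd j
      ≡⟨ cong (signAtStart j ⊛_) (≢⇒≡opposite (differentSigns⇒ends-differ j (different j))) ⟩
    signAtStart j ⊛ opposite (signAtStart j)       ≡⟨ s*opposite[s]≡- (signAtStart j) ⟩
    Sign.-
      ≡⟨ cong opposite (sym (s*s≡+ (signAtStart (next j)))) ⟩
    opposite (signAtStart (next j) ⊛ signAtStart (next j)) ∎
    where open ≡-Reasoning

  sameSign⇒dependent : 2 ∣ t → (∀ j → SameSign W τ₀ (c C j)) → Dependent W τ₀ C
  sameSign⇒dependent 2∣t same = dependent-by b λ j → begin
    b j ⊛ signAtEnd j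
      ≡⟨ cong (b j ⊛_) (sym (sameSign⇒ends-agree j (same j))) ⟩
    b j ⊛ signAtStart j                          ≡⟨ conjugate-sign (signAtStart j) (sign j) ⟩
    sign j                                       ≡⟨ sym (opposite-involutive (sign j)) ⟩
    opposite (opposite (sign j))                 ≡⟨ cong opposite (sym (alternating-next 2∣t j)) ⟩
    opposite (sign (next j))
      ≡⟨ cong opposite (sym (conjugate-sign (signAtStart (next j)) (sign (next j)))) ⟩
    opposite (b (next j) ⊛ signAtStart (next j)) ∎
    where
    open ≡-Reasoning
    sign : Fin t → Sign
    sign j = alternating (toℕ j)
    b : Fin t → Sign
    b j = signAtStart j ⊛ sign j

lemma5p3 : ∀ (n L : ℕ) (W : MoveSeq n L) (τ₀ : Config n) (t : ℕ) (C : Cycle W t)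
    → 2 ≤ t → 2 ∣ t
    → ((∀ j → DifferentSigns W τ₀ (c C j)) → Dependent W τ₀ C)
      × ((∀ j → SameSign W τ₀ (c C j)) → Dependent W τ₀ C)
lemma5p3 n L W τ₀ t C _ 2∣t =
  differentSigns⇒dependent W τ₀ C , sameSign⇒dependent W τ₀ C 2∣t
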